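{- Let $q$ be a prime power, $F=\mathrm{GF}(q)$, $s\ge 1$ an integer and $n=\frac{q^{s+1}-1}{q-1}$. Let $(C_1,\ldots,C_k)$ be a partition of $F^s$ into $1$-codes. Then there is a partition $(P_1,\ldots,P_{q^{s+1}})$ of $F^n$ into $1$-perfect codes such that for all $j=1,\ldots,k$, $$C_j=\{x\in F^s\mid (1,x,0^{n-s-1})\in P_j\}.$$
   Context: The Hamming distance between two vectors of the same length is the number of positions where they differ. The neighborhood $\Omega(M)$ of a set $M\subset F^N$ is the set of vectors at distance at most $1$ from some element of $M$. A set $C\subset F^N$ is a $1$-code if the neighborhoods of its elements are pairwise disjoint. A $1$-code $P\subset F^N$ is $1$-perfect if $\Omega(P)=F^N$. -}

module Defs where

open import Level using (0ℓ)
open import Data.Nat using (ℕ; zero; suc; _<?_; _∸_; _^_; _≤_; NonZero)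
open import Data.Nat.DivMod using (_/_)
open import Data.Fin using (Fin; _≟_; toℕ; fromℕ<)
open import Data.Vec using (Vec; []; _∷_; tabulate; lookup)
open import Data.Product using (Σ; _×_; _,_; ∃)
open import Relation.Nullary using (¬_; yes; no)
open import Relation.Unary using (Pred; _∈_)
open import Relation.Binary.PropositionalEquality using (_≡_; _≢_)
open import Algebra.Structures using (IsCommutativeRing)

-- A field structure on the finite set Fin q (with propositional equality).
-- Every finite field of order q is isomorphic to one of these, so
-- "F = GF(q)" is rendered as "a field structure on Fin q".
record FiniteField (q : ℕ) : Set where
  field
    _+_ _*_ : Fin q → Fin q → Fin q
    -_      : Fin q → Fin q
    0# 1#   : Fin q
    isCommutativeRing : IsCommutativeRing _≡_ _+_ _*_ -_ 0# 1#
    0≢1     : 0# ≢ 1#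
    inverse : ∀ x → x ≢ 0# → Σ (Fin q) λ y → x * y ≡ 1#

hamming : ∀ {q N} → Vec (Fin q) N → Vec (Fin q) N → ℕ
hamming [] [] = 0
hamming (x ∷ xs) (y ∷ ys) with x ≟ y
... | yes _ = hamming xs ys
... | no  _ = suc (hamming xs ys)

Ω : ∀ {q N} → Pred (Vec (Fin q) N) 0ℓ → Pred (Vec (Fin q) N) 0ℓ
Ω M v = ∃ λ c → c ∈ M × hamming c v ≤ 1

Is1Code : ∀ {q N} → Pred (Vec (Fin q) N) 0ℓ → Set
Is1Code {q} {N} C = ∀ c c' → c ∈ C → c' ∈ C → c ≢ c' →
  ∀ (v : Vec (Fin q) N) → ¬ (hamming c v ≤ 1 × hamming c' v ≤ 1)

Is1Perfect : ∀ {q N} → Pred (Vec (Fin q) N) 0ℓ → Set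
Is1Perfect {q} {N} P = Is1Code P × (∀ (v : Vec (Fin q) N) → v ∈ Ω P)

hammingLength : (q s : ℕ) → .{{NonZero (q ∸ 1)}} → ℕ
hammingLength q s = (q ^ suc s ∸ 1) / (q ∸ 1)

-- The vector (1, x, 0^(N-s-1)) ∈ F^N for x ∈ F^s (meaningful when N ≥ s+1):
-- coordinate 0 is 1#, coordinates 1..s are x, the remaining ones are 0#.
embed : ∀ {q} → (F : FiniteField q) → ∀ {s} N → Vec (Fin q) s → Vec (Fin q) N
embed F {s} N x = tabulate f
  where
  f : Fin N → _
  f i with toℕ i
  ... | zero = FiniteField.1# F
  ... | suc m with m <? s
  ...   | yes m<s = lookup x (fromℕ< m<s)
  ...   | no  _   = FiniteField.0# F

{-# OPTIONS --safe #-}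

-- Let H be a parity-check matrix of the Hamming code of length n, with columns pairwise
-- non-proportional in F^(s+1) and the first s+1 of them the unit vectors.  The syndrome y ↦ H y is
-- bijective on every ball of radius 1, so its fibres partition F^n into 1-perfect codes, but it gives
-- every word (1,x,0) the colour (1,x).  Choose distinct targets μ_j = (0,…), one for each class C_j.
-- For x ∈ C_j let d = (1,x) − μ_j, and let K_x be the set of y on which certain functionals
-- ⟨g ∘ H, y⟩, with g homogeneous and invariant under translation by d, take the same value as on
-- (1,x,0).  If two words in a common ball have syndromes differing by a multiple of d, then K_x
-- contains both or none; so exchanging the colours (1,x) and μ_j inside K_x preserves bijectivity on
-- balls.  All these exchanges can be made at once: those of different classes involve different
-- colours, and for x, x′ ∈ C_j the sets K_x and K_x′ are disjoint, because x − x′ has weight at least 3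
-- and so remains independent of any two unit vectors, which gives a functional g, invariant under both
-- directions, that separates (1,x,0) from (1,x′,0).
module Submission where

open import Defs
open import Algebra.Bundles using (CommutativeRing)
import Algebra.Solver.Ring.AlmostCommutativeRing as ACR
open import Data.Fin using (Fin; zero; suc; toℕ; fromℕ<; inject≤; punchIn; punchOut; remQuot; combine; funToFin; finToFun)
import Data.Fin as Fin
import Data.Fin.Properties as Finₚ
open import Data.Integer using (ℤ; +_; -[1+_]; _⊖_)
import Data.Integer as ℤ
import Data.Integer.Properties as ℤₚ
open import Data.Maybe using (Maybe; just; nothing)
open import Data.Nat using (ℕ; zero; suc; _≤_; _<_; _^_; _∸_; NonZero)
import Data.Nat as ℕ
import Data.Nat.DivMod as DivMod
import Data.Nat.Properties as ℕₚ
open import Data.Product using (Σ; _×_; _,_; ∃; ∃₂; proj₁; proj₂; uncurry)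
open import Data.Sum using (_⊎_; inj₁; inj₂)
open import Data.Vec using (Vec; []; _∷_; lookup; tabulate; updateAt; _[_]≔_)
open import Data.Vec.Functional using (removeAt)
import Data.Vec.Properties as Vecₚ
open import Function using (_∘_)
open import Function.Bundles using (_⇔_; mk⇔)
open import Relation.Binary.PropositionalEquality using (_≡_; _≢_; _≗_; refl; sym; trans; cong; cong₂; cong-app; subst; module ≡-Reasoning)
open import Relation.Nullary using (Dec; yes; no; ¬_; contradiction)
open import Relation.Nullary.Decidable using (map′; _×-dec_; _→-dec_; ¬?; decidable-stable)
open import Relation.Unary using (Decidable)

-- Ring solver with integer coefficients

-- The operations of an abstract field do not compute, so coefficients taken from it would not
-- cancel. Integers do compute, and the optimised multiple makes `con (+ 0)` and `con (+ 1)`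
-- evaluate to `0#` and `1#` definitionally.
module IntegerCoefficients {c ℓ} (R : CommutativeRing c ℓ) where
  open CommutativeRing R renaming (refl to ≈refl; sym to ≈sym; trans to ≈trans; reflexive to ≈reflexive)
  open import Algebra.Properties.Semiring.Mult.TCOptimised semiring renaming (_×_ to infixl 8 _·_)
  open import Algebra.Properties.Ring ring
  open import Relation.Binary.Reasoning.Setoid setoid
  import Algebra.Solver.CommutativeMonoid +-commutativeMonoid as S

  ⟦_⟧ : ℤ → Carrier
  ⟦ + n ⟧      = n · 1#
  ⟦ -[1+ n ] ⟧ = - (suc n · 1#)

  -‿homo : ∀ i → ⟦ ℤ.- i ⟧ ≈ - ⟦ i ⟧
  -‿homo (+ zero)   = ≈sym -0#≈0#
  -‿homo (+ suc n)  = ≈refl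
  -‿homo -[1+ n ]   = ≈sym (-‿involutive _)

  ⊖-homo : ∀ m n → ⟦ m ⊖ n ⟧ ≈ m · 1# - n · 1#
  ⊖-homo m zero = ≈sym (≈trans (+-congˡ -0#≈0#) (+-identityʳ _))
  ⊖-homo zero (suc n) = ≈sym (+-identityˡ _)
  ⊖-homo (suc m) (suc n) = begin
    ⟦ suc m ⊖ suc n ⟧                          ≡⟨ cong ⟦_⟧ (ℤₚ.[1+m]⊖[1+n]≡m⊖n m n) ⟩
    ⟦ m ⊖ n ⟧                                  ≈⟨ ⊖-homo m n ⟩
    m · 1# - n · 1#                            ≈⟨ +-congˡ (+-identityˡ _) ⟨
    m · 1# + (0# - n · 1#)                     ≈⟨ +-congˡ (+-congʳ (-‿inverseʳ 1#)) ⟨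
    m · 1# + (1# - 1# - n · 1#)                ≈⟨ S.solve 4 (λ a b c d → a S.⊕ ((b S.⊕ c) S.⊕ d) S.⊜ (b S.⊕ a) S.⊕ (c S.⊕ d)) ≈refl _ _ _ _ ⟩
    (1# + m · 1#) + (- 1# - n · 1#)            ≈⟨ +-cong (≈sym (1+× m 1#)) (≈trans (-‿+-comm 1# _) (-‿cong (≈sym (1+× n 1#)))) ⟩
    suc m · 1# - suc n · 1#                    ∎

  +-homo : ∀ i j → ⟦ i ℤ.+ j ⟧ ≈ ⟦ i ⟧ + ⟦ j ⟧
  +-homo (+ m)    (+ n)    = ×-homo-+ 1# m n
  +-homo (+ m)    -[1+ n ] = ⊖-homo m (suc n)
  +-homo -[1+ m ] (+ n)    = ≈trans (⊖-homo n (suc m)) (+-comm _ _)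
  +-homo -[1+ m ] -[1+ n ] = begin
    - (suc (suc (m ℕ.+ n)) · 1#)    ≡⟨ cong (λ k → - (suc k · 1#)) (sym (ℕₚ.+-suc m n)) ⟩
    - ((suc m ℕ.+ suc n) · 1#)      ≈⟨ -‿cong (×-homo-+ 1# (suc m) (suc n)) ⟩
    - (suc m · 1# + suc n · 1#)     ≈⟨ ≈sym (-‿+-comm _ _) ⟩
    - (suc m · 1#) - suc n · 1#     ∎

  *-homo⁺ : ∀ m i → ⟦ + m ℤ.* i ⟧ ≈ m · 1# * ⟦ i ⟧
  *-homo⁺ zero i = ≈trans (≈reflexive (cong ⟦_⟧ (ℤₚ.*-zeroˡ i))) (≈sym (zeroˡ _))
  *-homo⁺ (suc m) i = begin
    ⟦ + suc m ℤ.* i ⟧              ≡⟨ cong ⟦_⟧ (ℤₚ.suc-* (+ m) i) ⟩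
    ⟦ i ℤ.+ + m ℤ.* i ⟧            ≈⟨ +-homo i (+ m ℤ.* i) ⟩
    ⟦ i ⟧ + ⟦ + m ℤ.* i ⟧          ≈⟨ +-cong (≈sym (*-identityˡ _)) (*-homo⁺ m i) ⟩
    1# * ⟦ i ⟧ + m · 1# * ⟦ i ⟧    ≈⟨ distribʳ _ _ _ ⟨
    (1# + m · 1#) * ⟦ i ⟧          ≈⟨ *-congʳ (1+× m 1#) ⟨
    suc m · 1# * ⟦ i ⟧             ∎

  *-homo : ∀ i j → ⟦ i ℤ.* j ⟧ ≈ ⟦ i ⟧ * ⟦ j ⟧
  *-homo (+ m)    j = *-homo⁺ m j
  *-homo -[1+ m ] j = begin
    ⟦ -[1+ m ] ℤ.* j ⟧          ≡⟨ cong ⟦_⟧ (sym (ℤₚ.neg-distribˡ-* (+ suc m) j)) ⟩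
    ⟦ ℤ.- (+ suc m ℤ.* j) ⟧     ≈⟨ -‿homo (+ suc m ℤ.* j) ⟩
    - ⟦ + suc m ℤ.* j ⟧         ≈⟨ -‿cong (*-homo⁺ (suc m) j) ⟩
    - (suc m · 1# * ⟦ j ⟧)      ≈⟨ -‿distribˡ-* _ _ ⟩
    - (suc m · 1#) * ⟦ j ⟧      ∎

  morphism : ℤ.+-*-rawRing ACR.-Raw-AlmostCommutative⟶ ACR.fromCommutativeRing R
  morphism = record
    { ⟦_⟧ = ⟦_⟧ ; +-homo = +-homo ; *-homo = *-homo ; -‿homo = -‿homo
    ; 0-homo = ≈refl ; 1-homo = ≈refl }

  coeff≟ : ∀ i j → Maybe (⟦ i ⟧ ≈ ⟦ j ⟧)
  coeff≟ i j with i ℤ.≟ j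
  ... | yes i≡j = just (≈reflexive (cong ⟦_⟧ i≡j))
  ... | no  _   = nothing

  open import Algebra.Solver.Ring _ _ morphism coeff≟ public using (solve; con; _:=_; _:+_; _:*_; _:-_; :-_)

-- Finite fields and columns of the parity-check matrix

funToFin-cong : ∀ {m n} {f g : Fin m → Fin n} → f ≗ g → funToFin f ≡ funToFin g
funToFin-cong {zero}  f≗g = refl
funToFin-cong {suc m} f≗g = cong₂ combine (f≗g zero) (funToFin-cong (f≗g ∘ suc))

funToFin-injective : ∀ {m n} {f g : Fin m → Fin n} → funToFin f ≡ funToFin g → f ≗ g
funToFin-injective {f = f} {g} eq k =
  trans (sym (Finₚ.finToFun-funToFin f k))
        (trans (cong (λ e → finToFun e k) eq) (Finₚ.finToFun-funToFin g k))

finToFun-injective : ∀ {m n} {e e′ : Fin (n ^ m)} → finToFun {n} {m} e ≗ finToFun e′ → e ≡ e′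
finToFun-injective {m} {n} {e} {e′} eq =
  trans (sym (Finₚ.funToFin-finToFin {m} {n} e)) (trans (funToFin-cong eq) (Finₚ.funToFin-finToFin {m} {n} e′))

module FieldProperties {q : ℕ} (F : FiniteField q) where
  open FiniteField F public using (0≢1; inverse)

  commutativeRing : CommutativeRing _ _
  commutativeRing = record { isCommutativeRing = FiniteField.isCommutativeRing F }

  open CommutativeRing commutativeRing public
    using (_+_; _*_; -_; _-_; 0#; 1#; zeroˡ; zeroʳ; *-identityˡ; +-identityˡ; +-identityʳ;
           +-assoc; -‿inverseʳ; +-commutativeMonoid; +-group)
  open IntegerCoefficients commutativeRing public
    using (solve; con; _:=_; _:+_; _:*_; _:-_; :-_)
  open import Algebra.Properties.Group +-group public
    using () renaming (x∙y⁻¹≈ε⇒x≈y to x-y≡0⇒x≡y; ∙-cancelʳ to +-cancelʳ; ∙-cancelˡ to +-cancelˡ)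

  V : ℕ → Set
  V d = Fin d → Fin q

  *-solve : ∀ {a a⁻¹ b c} → a * a⁻¹ ≡ 1# → a * b ≡ c → b ≡ a⁻¹ * c
  *-solve {a} {a⁻¹} {b} {c} aa⁻¹≡1 ab≡c = begin
    b                ≡⟨ *-identityˡ b ⟨
    1# * b           ≡⟨ cong (_* b) aa⁻¹≡1 ⟨
    a * a⁻¹ * b      ≡⟨ solve 3 (λ a a⁻¹ b → a :* a⁻¹ :* b := a⁻¹ :* (a :* b)) refl a a⁻¹ b ⟩
    a⁻¹ * (a * b)    ≡⟨ cong (a⁻¹ *_) ab≡c ⟩
    a⁻¹ * c          ∎
    where open ≡-Reasoning

  *-cancel-nonzero : ∀ {a b} → a ≢ 0# → a * b ≡ 0# → b ≡ 0#
  *-cancel-nonzero a≢0 ab≡0 = trans (*-solve (proj₂ (inverse _ a≢0)) ab≡0) (zeroʳ _)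

module Columns {r : ℕ} (F : FiniteField (suc r)) (d : ℕ) where
  open FieldProperties F

  -- Independence is pairwise only: the first `m` columns are distinct points of a projective space.
  -- Indexing by `ℕ` lets columns be appended without renaming the old ones; values from `m` on
  -- carry no meaning.
  record Independent (m : ℕ) (H : ℕ → V d) : Set where
    field
      nonzero         : ∀ {i} → i < m → ¬ (∀ k → H i k ≡ 0#)
      nonproportional : ∀ {i j} → i < m → j < m → i ≢ j → ∀ c → ¬ (∀ k → H i k ≡ c * H j k)

  Covered : ℕ → (ℕ → V d) → V d → Set
  Covered m H v = ∃₂ λ (i : Fin m) a → ∀ k → v k ≡ a * H (toℕ i) k

  -- Together with `Independent m H` this makes every projective point occur exactly once, so `H` is
  -- a parity-check matrix of a Hamming code.
  Covers : ℕ → (ℕ → V d) → Set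
  Covers m H = ∀ v → Covered m H v

  unit : ℕ → V d
  unit i k with i ℕ.≟ toℕ k
  ... | yes _ = 1#
  ... | no  _ = 0#

  unit-diag : ∀ {i} k → i ≡ toℕ k → unit i k ≡ 1#
  unit-diag {i} k i≡k with i ℕ.≟ toℕ k
  ... | yes _   = refl
  ... | no  i≢k = contradiction i≡k i≢k

  unit-off : ∀ {i} k → i ≢ toℕ k → unit i k ≡ 0#
  unit-off {i} k i≢k with i ℕ.≟ toℕ k
  ... | yes i≡k = contradiction i≡k i≢k
  ... | no  _   = refl

  unit-independent : Independent d unit
  unit-independent = record
    { nonzero = λ i<d eq → 0≢1 (trans (sym (eq (fromℕ< i<d))) (unit-diag _ (sym (Finₚ.toℕ-fromℕ< i<d))))
    ; nonproportional = λ {i} {j} i<d j<d i≢j c eq → 0≢1 (begin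
        0#                        ≡⟨ zeroʳ c ⟨
        c * 0#                    ≡⟨ cong (c *_) (unit-off (fromℕ< i<d) (λ j≡ → i≢j (sym (trans j≡ (Finₚ.toℕ-fromℕ< i<d))))) ⟨
        c * unit j (fromℕ< i<d)   ≡⟨ eq _ ⟨
        unit i (fromℕ< i<d)       ≡⟨ unit-diag _ (sym (Finₚ.toℕ-fromℕ< i<d)) ⟩
        1#                        ∎)
    }
    where open ≡-Reasoning

  module _ {m H} (ind : Independent m H) where
    open Independent ind

    -- The lines spanned by two different columns meet only in the origin.
    common-multiple : ∀ {i j a b} → i < m → j < m → (∀ k → a * H i k ≡ b * H j k) →
                      (a ≡ 0# × b ≡ 0#) ⊎ (i ≡ j × a ≡ b)
    common-multiple {i} {j} {a} {b} i<m j<m eq with a Fin.≟ 0# | b Fin.≟ 0# | i ℕ.≟ j | a Fin.≟ b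
    ... | yes refl | yes refl | _ | _ = inj₁ (refl , refl)
    ... | yes refl | no b≢0 | _ | _ =
      contradiction (λ k → *-cancel-nonzero b≢0 (trans (sym (eq k)) (zeroˡ _))) (nonzero j<m)
    ... | no a≢0 | _ | yes i≡j | yes a≡b = inj₂ (i≡j , a≡b)
    ... | no a≢0 | _ | yes refl | no a≢b =
      contradiction (λ k → *-cancel-nonzero (a≢b ∘ x-y≡0⇒x≡y a b) (begin
        (a - b) * H i k        ≡⟨ solve 3 (λ a b h → (a :- b) :* h := a :* h :- b :* h) refl a b (H i k) ⟩
        a * H i k - b * H i k  ≡⟨ cong (_- b * H i k) (eq k) ⟩
        b * H i k - b * H i k  ≡⟨ -‿inverseʳ _ ⟩
        0#                     ∎)) (nonzero i<m)
      where open ≡-Reasoning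
    ... | no a≢0 | _ | no i≢j | _ with inverse a a≢0
    ...   | a⁻¹ , aa⁻¹≡1 =
      contradiction (λ k → trans (*-solve aa⁻¹≡1 (eq k))
                                 (solve 3 (λ x y z → x :* (y :* z) := x :* y :* z) refl a⁻¹ b (H j k)))
                    (nonproportional i<m j<m i≢j (a⁻¹ * b))

  -- Index 0 stands for the zero vector, and `punchIn 0#` runs through the `r` nonzero scalars. The
  -- index set has the size of a ball of radius 1 in length `m`.
  multiple : ∀ m (H : ℕ → V d) → Fin (suc (m ℕ.* r)) → V d
  multiple m H zero    k = 0#
  multiple m H (suc e) k = let i , t = remQuot {m} r e in punchIn 0# t * H (toℕ i) k

  multiple-injective : ∀ {m H} → Independent m H → ∀ {e e′} → multiple m H e ≗ multiple m H e′ → e ≡ e′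
  multiple-injective ind {zero} {zero} eq = refl
  multiple-injective {m} ind {zero} {suc e′} eq =
    contradiction (λ k → *-cancel-nonzero (Finₚ.punchInᵢ≢i 0# (proj₂ (remQuot {m} r e′))) (sym (eq k)))
                  (Independent.nonzero ind (Finₚ.toℕ<n (proj₁ (remQuot {m} r e′))))
  multiple-injective {m} ind {suc e} {zero} eq =
    contradiction (λ k → *-cancel-nonzero (Finₚ.punchInᵢ≢i 0# (proj₂ (remQuot {m} r e))) (eq k))
                  (Independent.nonzero ind (Finₚ.toℕ<n (proj₁ (remQuot {m} r e))))
  multiple-injective {m} ind {suc e} {suc e′} eq
    with common-multiple ind (Finₚ.toℕ<n (proj₁ (remQuot {m} r e))) (Finₚ.toℕ<n (proj₁ (remQuot {m} r e′))) eq
  ... | inj₁ (a≡0 , _) = contradiction a≡0 (Finₚ.punchInᵢ≢i 0# (proj₂ (remQuot {m} r e)))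
  ... | inj₂ (i≡j , a≡b) = cong suc (begin
    e                                   ≡⟨ Finₚ.combine-remQuot {m} r e ⟨
    uncurry combine (remQuot {m} r e)   ≡⟨ cong₂ combine (Finₚ.toℕ-injective i≡j) (Finₚ.punchIn-injective 0# _ _ a≡b) ⟩
    uncurry combine (remQuot {m} r e′)  ≡⟨ Finₚ.combine-remQuot {m} r e′ ⟩
    e′                                  ∎)
    where open ≡-Reasoning

  multiple-surjective : ∀ {m H v} → Covered m H v → ∃ λ e → multiple m H e ≗ v
  multiple-surjective {m} {H} {v} (i , a , v≗ah) with 0# Fin.≟ a
  ... | yes refl = zero , λ k → sym (trans (v≗ah k) (zeroˡ _))
  ... | no  0≢a  = suc (combine i (punchOut 0≢a)) , λ k → begin
    multiple m H (suc (combine i (punchOut 0≢a))) k ≡⟨ cong (λ p → punchIn 0# (proj₂ p) * H (toℕ (proj₁ p)) k) (Finₚ.remQuot-combine i (punchOut 0≢a)) ⟩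
    punchIn 0# (punchOut 0≢a) * H (toℕ i) k         ≡⟨ cong (_* H (toℕ i) k) (Finₚ.punchIn-punchOut 0≢a) ⟩
    a * H (toℕ i) k                                 ≡⟨ v≗ah k ⟨
    v k                                             ∎
    where open ≡-Reasoning

  -- Sphere packing: the enumerated multiples are distinct vectors. With the converse bound
  -- `covers⇒≥` it determines the length; alone it makes `complete` stop.
  independent⇒≤ : ∀ {m H} → Independent m H → suc (m ℕ.* r) ≤ suc r ^ d
  independent⇒≤ ind = Finₚ.injective⇒≤ (multiple-injective ind ∘ funToFin-injective)

  covers⇒≥ : ∀ {m H} → Covers m H → suc r ^ d ≤ suc (m ℕ.* r)
  covers⇒≥ {m} {H} cov = Finₚ.injective⇒≤ {f = proj₁ ∘ pre} λ {e} {e′} eq →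
    finToFun-injective λ k →
      trans (sym (proj₂ (pre e) k)) (trans (cong (λ f → multiple m H f k) eq) (proj₂ (pre e′) k))
    where
    pre : ∀ e → ∃ λ f → multiple m H f ≗ finToFun e
    pre e = multiple-surjective (cov (finToFun e))

  covered? : ∀ m H → Decidable (Covered m H)
  covered? m H v = Finₚ.any? λ i → Finₚ.any? λ a → Finₚ.all? λ k → v k Fin.≟ a * H (toℕ i) k

  covered-cong : ∀ {m H u v} → u ≗ v → Covered m H u → Covered m H v
  covered-cong u≗v (i , a , eq) = i , a , λ k → trans (sym (u≗v k)) (eq k)

  extend : ℕ → (ℕ → V d) → V d → ℕ → V d
  extend m H v i with i ℕ.≟ m
  ... | yes _ = v
  ... | no  _ = H i

  extend-old : ∀ {m} H v {i} → i < m → extend m H v i ≡ H i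
  extend-old {m} H v {i} i<m with i ℕ.≟ m
  ... | yes refl = contradiction i<m (ℕₚ.<-irrefl refl)
  ... | no  _    = refl

  extend-independent : ∀ {m H v} → Independent m H → ¬ Covered m H v → 0 < m → Independent (suc m) (extend m H v)
  extend-independent {m} {H} {v} ind ¬cov 0<m = record { nonzero = nz ; nonproportional = np }
    where
    open Independent ind
    below : ∀ {i} → i < suc m → i ≢ m → i < m
    below i<1+m i≢m = ℕₚ.≤∧≢⇒< (ℕₚ.≤-pred i<1+m) i≢m

    v-uncovered : ∀ {j} a → j < m → ¬ (∀ k → v k ≡ a * H j k)
    v-uncovered a j<m eq = ¬cov (fromℕ< j<m , a , λ k → trans (eq k) (cong (λ j → a * H j k) (sym (Finₚ.toℕ-fromℕ< j<m))))

    nz : ∀ {i} → i < suc m → ¬ (∀ k → extend m H v i k ≡ 0#)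
    nz {i} i<1+m eq with i ℕ.≟ m
    -- A zero `v` would be covered, as the zero multiple of column 0, which exists by `0<m`.
    ... | yes refl = v-uncovered 0# 0<m λ k → trans (eq k) (sym (zeroˡ _))
    ... | no i≢m   = nonzero (below i<1+m i≢m) eq

    np : ∀ {i j} → i < suc m → j < suc m → i ≢ j → ∀ c → ¬ (∀ k → extend m H v i k ≡ c * extend m H v j k)
    np {i} {j} i<1+m j<1+m i≢j c eq with i ℕ.≟ m | j ℕ.≟ m
    ... | yes refl | yes refl = i≢j refl
    ... | yes refl | no j≢m   = v-uncovered c (below j<1+m j≢m) eq
    ... | no i≢m   | no j≢m   = nonproportional (below i<1+m i≢m) (below j<1+m j≢m) i≢j c eq
    ... | no i≢m   | yes refl with c Fin.≟ 0#
    ...   | yes refl = nonzero (below i<1+m i≢m) λ k → trans (eq k) (zeroˡ _)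
    ...   | no  c≢0 with inverse c c≢0
    ...     | c⁻¹ , cc⁻¹≡1 = v-uncovered c⁻¹ (below i<1+m i≢m) λ k → *-solve cc⁻¹≡1 (sym (eq k))

  record Completion (m : ℕ) (H : ℕ → V d) : Set where
    field
      size        : ℕ
      columns     : ℕ → V d
      independent : Independent size columns
      covers      : Covers size columns
      m≤size      : m ≤ size
      agrees      : ∀ {i} → i < m → columns i ≡ H i

  -- Greedy: an uncovered vector is appended as long as there is one. The sum `fuel + m` is
  -- invariant, so exhausted fuel means more than `suc r ^ d` pairwise independent columns, against
  -- `independent⇒≤`.
  complete : .{{_ : ℕ.NonZero r}} → ∀ fuel {m H} → Independent m H → 0 < m → suc r ^ d < fuel ℕ.+ m → Completion m H
  complete zero {m} ind _ N<m = contradiction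
    (ℕₚ.≤-trans (ℕₚ.m≤m*n m r) (ℕₚ.≤-trans (ℕₚ.n≤1+n _) (independent⇒≤ ind))) (ℕₚ.<⇒≱ N<m)
  complete (suc fuel) {m} {H} ind 0<m N< with Finₚ.all? (λ e → covered? m H (finToFun e))
  ... | yes cov = record
    { size = m ; columns = H ; independent = ind ; m≤size = ℕₚ.≤-refl ; agrees = λ _ → refl
    ; covers = λ v → covered-cong {H = H} (Finₚ.finToFun-funToFin v) (cov (funToFin v)) }
  ... | no ¬cov with Finₚ.¬∀⟶∃¬ _ _ (λ e → covered? m H (finToFun e)) ¬cov
  ...   | e , ¬cov-e = record
    { Completion C hiding (m≤size; agrees)
    ; m≤size = ℕₚ.≤-trans (ℕₚ.n≤1+n m) (Completion.m≤size C)
    ; agrees = λ i<m → trans (Completion.agrees C (ℕₚ.m≤n⇒m≤1+n i<m)) (extend-old H _ i<m) }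
    where
    C = complete fuel (extend-independent ind ¬cov-e 0<m) (ℕ.s≤s ℕ.z≤n)
          (subst (suc r ^ d <_) (sym (ℕₚ.+-suc fuel m)) N<)

-- Words and linear functionals

lookup-ext : ∀ {A : Set} {n} {xs ys : Vec A n} → lookup xs ≗ lookup ys → xs ≡ ys
lookup-ext {xs = xs} {ys} eq =
  trans (sym (Vecₚ.tabulate∘lookup xs)) (trans (Vecₚ.tabulate-cong eq) (Vecₚ.tabulate∘lookup ys))

hamming-refl : ∀ {q n} (xs : Vec (Fin q) n) → hamming xs xs ≡ 0
hamming-refl [] = refl
hamming-refl (x ∷ xs) with x Fin.≟ x
... | yes _   = hamming-refl xs
... | no  x≢x = contradiction refl x≢x

hamming≤0⇒≡ : ∀ {q n} (xs ys : Vec (Fin q) n) → hamming xs ys ≤ 0 → xs ≡ ys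
hamming≤0⇒≡ [] [] _ = refl
hamming≤0⇒≡ (x ∷ xs) (y ∷ ys) d≤0 with x Fin.≟ y
... | yes refl = cong (x ∷_) (hamming≤0⇒≡ xs ys d≤0)

agree-off⇒hamming≤1 : ∀ {q n} (xs ys : Vec (Fin q) n) i →
                      (∀ k → k ≢ i → lookup xs k ≡ lookup ys k) → hamming xs ys ≤ 1
agree-off⇒hamming≤1 (x ∷ xs) (y ∷ ys) zero agree
  rewrite lookup-ext {xs = xs} {ys} (λ k → agree (suc k) λ ()) with x Fin.≟ y
... | yes _ = subst (_≤ 1) (sym (hamming-refl ys)) ℕ.z≤n
... | no  _ = ℕ.s≤s (ℕₚ.≤-reflexive (hamming-refl ys))
agree-off⇒hamming≤1 (x ∷ xs) (y ∷ ys) (suc i) agree with x Fin.≟ y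
... | yes _   = agree-off⇒hamming≤1 xs ys i λ k k≢i → agree (suc k) (k≢i ∘ Finₚ.suc-injective)
... | no  x≢y = contradiction (agree zero λ ()) x≢y

-- Otherwise changing x in position i to agree with x′ would give a common neighbour of x and x′.
differ-off-two : ∀ {q n} {C : Vec (Fin q) n → Set} → Is1Code C → ∀ {x x′} → C x → C x′ → x ≢ x′ →
                 ∀ i l → ∃ λ m → m ≢ i × m ≢ l × lookup x m ≢ lookup x′ m
differ-off-two code {x} {x′} Cx Cx′ x≢x′ i l
  with Finₚ.any? (λ m → ¬? (m Fin.≟ i) ×-dec ¬? (m Fin.≟ l) ×-dec ¬? (lookup x m Fin.≟ lookup x′ m))
... | yes found = found
... | no  none  = contradiction
  (agree-off⇒hamming≤1 x v i (λ k k≢i → sym (Vecₚ.lookup∘updateAt′ k i k≢i x)) , agree-off⇒hamming≤1 x′ v l x′-agrees)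
  (code x x′ Cx Cx′ x≢x′ v)
  where
  v = x [ i ]≔ lookup x′ i
  x′-agrees : ∀ k → k ≢ l → lookup x′ k ≡ lookup v k
  x′-agrees k k≢l with k Fin.≟ i
  ... | yes refl = sym (Vecₚ.lookup∘updateAt i x)
  ... | no  k≢i  = trans (sym (decidable-stable (lookup x k Fin.≟ lookup x′ k) λ ≢ → none (k , k≢i , k≢l , ≢)))
                         (sym (Vecₚ.lookup∘updateAt′ k i k≢i x))

-- The entry function of `embed` is local to it. Unification against `refl` recovers it here, and
-- abstracting `toℕ t` then lets it compute.
lookup-≡tabulate : ∀ {A : Set} {n} {xs : Vec A n} {f} → xs ≡ tabulate f → lookup xs ≗ f
lookup-≡tabulate refl = Vecₚ.lookup∘tabulate _

module _ {q : ℕ} (F : FiniteField q) {n s : ℕ} (x : Vec (Fin q) s) (t : Fin n) where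

  embed-head : toℕ t ≡ 0 → lookup (embed F n x) t ≡ FiniteField.1# F
  embed-head eq with toℕ t | eq | lookup-≡tabulate {xs = embed F n x} refl t
  ... | zero | _ | lookup≡1 = lookup≡1

  embed-middle : ∀ l → toℕ t ≡ suc (toℕ l) → lookup (embed F n x) t ≡ lookup x l
  embed-middle l eq with toℕ t | eq | lookup-≡tabulate {xs = embed F n x} refl t
  ... | suc m | eq′ | lookup≡ with m ℕ.<? s
  ...   | yes m<s = trans lookup≡ (cong (lookup x)
                      (Finₚ.toℕ-injective (trans (Finₚ.toℕ-fromℕ< m<s) (ℕₚ.suc-injective eq′))))
  ...   | no  m≮s = contradiction (subst (_< s) (sym (ℕₚ.suc-injective eq′)) (Finₚ.toℕ<n l)) m≮s

  embed-tail : s < toℕ t → lookup (embed F n x) t ≡ FiniteField.0# F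
  embed-tail s<t with toℕ t | s<t | lookup-≡tabulate {xs = embed F n x} refl t
  ... | suc m | ℕ.s≤s s≤m | lookup≡ with m ℕ.<? s
  ...   | yes m<s = contradiction s≤m (ℕₚ.<⇒≱ m<s)
  ...   | no  _   = lookup≡

data Position {s} (m : ℕ) : Set where
  head   : m ≡ 0 → Position m
  middle : ∀ (l : Fin s) → m ≡ suc (toℕ l) → Position m
  tail   : s < m → Position m

position : ∀ s m → Position {s} m
position s zero = head refl
position s (suc m) with m ℕ.<? s
... | yes m<s = middle (fromℕ< m<s) (cong suc (sym (Finₚ.toℕ-fromℕ< m<s)))
... | no  m≮s = tail (ℕ.s≤s (ℕₚ.≮⇒≥ m≮s))

module Linear {q : ℕ} (F : FiniteField q) where
  open FieldProperties F
  open import Algebra.Properties.CommutativeMonoid.Sum +-commutativeMonoid using (sum; sum-remove; sum-cong-≗; sum-replicate-zero)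

  sum-differ-at : ∀ {n} (f g : Fin n → Fin q) t → (∀ k → k ≢ t → f k ≡ g k) → sum f ≡ sum g + (f t - g t)
  sum-differ-at {suc n} f g t agree = begin
    sum f                                      ≡⟨ sum-remove {i = t} f ⟩
    f t + sum (removeAt f t)                   ≡⟨ cong (_+_ (f t)) (sum-cong-≗ λ k → agree (punchIn t k) (Finₚ.punchInᵢ≢i t k)) ⟩
    f t + sum (removeAt g t)                   ≡⟨ solve 3 (λ a b c → a :+ c := b :+ c :+ (a :- b)) refl (f t) (g t) _ ⟩
    g t + sum (removeAt g t) + (f t - g t)     ≡⟨ cong (_+ (f t - g t)) (sum-remove {i = t} g) ⟨
    sum g + (f t - g t)                        ∎
    where open ≡-Reasoning

  opaque
    dot : ∀ {n} → V n → Vec (Fin q) n → Fin q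
    dot a y = sum λ k → a k * lookup y k

    dot-congˡ : ∀ {n} {a b : V n} y → a ≗ b → dot a y ≡ dot b y
    dot-congˡ y a≗b = sum-cong-≗ λ k → cong (_* lookup y k) (a≗b k)

    dot-differ-at : ∀ {n} (a : V n) y y′ t → (∀ k → k ≢ t → a k * lookup y k ≡ a k * lookup y′ k) →
                    dot a y ≡ dot a y′ + (a t * lookup y t - a t * lookup y′ t)
    dot-differ-at a y y′ = sum-differ-at _ _

    dot-single : ∀ {n} (a : V n) y t → (∀ k → k ≢ t → a k * lookup y k ≡ 0#) → dot a y ≡ a t * lookup y t
    dot-single {n} a y t vanish = begin
      dot a y                                               ≡⟨ sum-differ-at _ (λ _ → 0#) t vanish ⟩
      sum {n} (λ _ → 0#) + (a t * lookup y t - 0#)          ≡⟨ cong (_+ (a t * lookup y t - 0#)) (sum-replicate-zero n) ⟩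
      0# + (a t * lookup y t - 0#)                          ≡⟨ solve 1 (λ x → con (+ 0) :+ (x :- con (+ 0)) := x) refl _ ⟩
      a t * lookup y t                                      ∎
      where open ≡-Reasoning

  bump : ∀ {n} → Vec (Fin q) n → Fin n → Fin q → Vec (Fin q) n
  bump w i a = updateAt w i (_+ a)

  dot-bump : ∀ {n} (c : V n) w i a → dot c (bump w i a) ≡ dot c w + a * c i
  dot-bump c w i a = begin
    dot c (bump w i a)
      ≡⟨ dot-differ-at c (bump w i a) w i (λ k k≢i → cong (c k *_) (Vecₚ.lookup∘updateAt′ k i k≢i w)) ⟩
    dot c w + (c i * lookup (bump w i a) i - c i * lookup w i)
      ≡⟨ cong (λ z → dot c w + (c i * z - c i * lookup w i)) (Vecₚ.lookup∘updateAt i w) ⟩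
    dot c w + (c i * (lookup w i + a) - c i * lookup w i)
      ≡⟨ cong (_+_ (dot c w)) (solve 3 (λ c w a → c :* (w :+ a) :- c :* w := a :* c) refl (c i) (lookup w i) a) ⟩
    dot c w + a * c i ∎
    where open ≡-Reasoning

  -- The ball around `w` as position and size of an error. The centre is the error `0#` at any
  -- position, so a position must be supplied to recover it from the distance.
  Near : ∀ {n} → Vec (Fin q) n → Vec (Fin q) n → Set
  Near w y = ∃₂ λ i a → y ≡ bump w i a

  bump-zero : ∀ {n} (w : Vec (Fin q) n) i → bump w i 0# ≡ w
  bump-zero w i = Vecₚ.updateAt-id-local i w (+-identityʳ _)

  near⇒hamming≤1 : ∀ {n} {w y : Vec (Fin q) n} → Near w y → hamming y w ≤ 1
  near⇒hamming≤1 {w = w} (i , a , refl) =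
    agree-off⇒hamming≤1 (bump w i a) w i λ k k≢i → Vecₚ.lookup∘updateAt′ k i k≢i w

  hamming≤1⇒near : ∀ {n} (w y : Vec (Fin q) n) → Fin n → hamming y w ≤ 1 → Near w y
  hamming≤1⇒near w y i₀ d≤1 with differ w y d≤1
    where
    differ : ∀ {n} (w y : Vec (Fin q) n) → hamming y w ≤ 1 → y ≡ w ⊎ Near w y
    differ [] [] _ = inj₁ refl
    differ (z ∷ w) (x ∷ y) d≤1 with x Fin.≟ z
    differ (z ∷ w) (x ∷ y) d≤1 | yes refl with differ w y d≤1
    ... | inj₁ refl           = inj₁ refl
    ... | inj₂ (i , a , refl) = inj₂ (suc i , a , refl)
    differ (z ∷ w) (x ∷ y) (ℕ.s≤s d≤0) | no _ = inj₂ (zero , x - z , cong₂ _∷_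
      (solve 2 (λ x z → x := z :+ (x :- z)) refl x z) (hamming≤0⇒≡ y w d≤0))
  ... | inj₁ refl = i₀ , 0# , sym (bump-zero w i₀)
  ... | inj₂ near = near

-- The functional of p, z, u is homogeneous, invariant under translation by p and z, and 1 at u (when
-- u is independent of p and z); it need not be additive.
module Functional {q : ℕ} (F : FiniteField q) {d : ℕ} where
  open FieldProperties F

  Coefficient : (p z u v : V d) → Fin q → Set
  Coefficient p z u v c = ∃₂ λ t t′ → ∀ k → v k ≡ c * u k + (t * p k + t′ * z k)

  coefficient? : ∀ p z u v → Decidable (Coefficient p z u v)
  coefficient? p z u v c = Finₚ.any? λ t → Finₚ.any? λ t′ → Finₚ.all? λ k → v k Fin.≟ _

  opaque
    functional : (p z u : V d) → V d → Fin q
    functional p z u v with Finₚ.any? (coefficient? p z u v)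
    ... | yes (c , _) = c
    -- The complement of the span of `p`, `z`, `u` is stable under nonzero scaling and under
    -- translation by `p` and `z`, so a constant 0 there is compatible with homogeneity and spares
    -- the choice of a basis.
    ... | no  _       = 0#

  module _ {p z u : V d}
           (free : ∀ c t t′ → (∀ k → c * u k + (t * p k + t′ * z k) ≡ 0#) → c ≡ 0#) where

    coefficient-unique : ∀ {v c c′} → Coefficient p z u v c → Coefficient p z u v c′ → c ≡ c′
    coefficient-unique {v} {c} {c′} (t , t′ , eq) (t₁ , t₁′ , eq₁) =
      x-y≡0⇒x≡y c c′ (free (c - c′) (t - t₁) (t′ - t₁′) λ k → begin
        (c - c′) * u k + ((t - t₁) * p k + (t′ - t₁′) * z k)
          ≡⟨ solve 9 (λ c c′ t t₁ t′ t₁′ u p z →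
               (c :- c′) :* u :+ ((t :- t₁) :* p :+ (t′ :- t₁′) :* z) :=
               (c :* u :+ (t :* p :+ t′ :* z)) :- (c′ :* u :+ (t₁ :* p :+ t₁′ :* z)))
               refl c c′ t t₁ t′ t₁′ (u k) (p k) (z k) ⟩
        (c * u k + (t * p k + t′ * z k)) - (c′ * u k + (t₁ * p k + t₁′ * z k))
          ≡⟨ cong₂ _-_ (sym (eq k)) (sym (eq₁ k)) ⟩
        v k - v k
          ≡⟨ -‿inverseʳ _ ⟩
        0# ∎)
      where open ≡-Reasoning

    opaque
      unfolding functional

      functional-coefficient : ∀ {v c} → Coefficient p z u v c → functional p z u v ≡ c
      functional-coefficient {v} co with Finₚ.any? (coefficient? p z u v)
      ... | yes (_ , co′) = coefficient-unique co′ co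
      ... | no  none      = contradiction (_ , co) none

    -- Dividing by `a` expresses `w` through `v` and `p`, so membership in the span passes from `v`
    -- to `w`.
    coefficient-transfer : ∀ {a b t c} {v w : V d} → a ≢ 0# → (∀ k → b * v k ≡ a * w k + t * p k) →
                           Coefficient p z u v c → ∃ (Coefficient p z u w)
    coefficient-transfer {a} {b} {t} {c} {v} {w} a≢0 eq (t₁ , t₁′ , v≡) with inverse a a≢0
    ... | a⁻¹ , aa⁻¹≡1 = a⁻¹ * (b * c) , a⁻¹ * (b * t₁ - t) , a⁻¹ * (b * t₁′) , λ k →
      trans (*-solve {c = b * v k - t * p k} aa⁻¹≡1
              (trans (solve 2 (λ x y → x := x :+ y :- y) refl (a * w k) (t * p k)) (cong (_- t * p k) (sym (eq k)))))
            (trans (cong (λ v → a⁻¹ * (b * v - t * p k)) (v≡ k))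
              (solve 9 (λ a⁻¹ b c t t₁ t₁′ u p z →
                 a⁻¹ :* (b :* (c :* u :+ (t₁ :* p :+ t₁′ :* z)) :- t :* p) :=
                 a⁻¹ :* (b :* c) :* u :+ (a⁻¹ :* (b :* t₁ :- t) :* p :+ a⁻¹ :* (b :* t₁′) :* z))
                 refl a⁻¹ b c t t₁ t₁′ (u k) (p k) (z k)))

    -- Here `b * v` is a multiple of `p`, so its `u`-part must vanish.
    coefficient-vanish : ∀ {b t c} {v w : V d} → (∀ k → b * v k ≡ 0# * w k + t * p k) →
                         Coefficient p z u v c → b * c ≡ 0#
    coefficient-vanish {b} {t} {c} {v} {w} eq (t₁ , t₁′ , v≡) = free (b * c) (b * t₁ - t) (b * t₁′) λ k → begin
      b * c * u k + ((b * t₁ - t) * p k + b * t₁′ * z k)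
        ≡⟨ solve 8 (λ b c t t₁ t₁′ u p z →
             b :* c :* u :+ ((b :* t₁ :- t) :* p :+ b :* t₁′ :* z) :=
             b :* (c :* u :+ (t₁ :* p :+ t₁′ :* z)) :- t :* p) refl b c t t₁ t₁′ (u k) (p k) (z k) ⟩
      b * (c * u k + (t₁ * p k + t₁′ * z k)) - t * p k
        ≡⟨ cong (λ v → b * v - t * p k) (v≡ k) ⟨
      b * v k - t * p k
        ≡⟨ cong (_- t * p k) (eq k) ⟩
      0# * w k + t * p k - t * p k
        ≡⟨ solve 2 (λ w x → con (+ 0) :* w :+ x :- x := con (+ 0)) refl (w k) (t * p k) ⟩
      0# ∎
      where open ≡-Reasoning

    opaque
      unfolding functional

      -- Scaling and translation by `p` are combined in one relation, the one satisfied by the error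
      -- vectors of two words in a common ball whose syndromes differ by a multiple of `p`.
      functional-homogeneous : ∀ {a b t} {v w : V d} → (∀ k → b * v k ≡ a * w k + t * p k) →
                               b * functional p z u v ≡ a * functional p z u w
      functional-homogeneous {a} {b} {t} {v} {w} eq
        with Finₚ.any? (coefficient? p z u v) | Finₚ.any? (coefficient? p z u w)
      ... | no _ | no _ = trans (zeroʳ b) (sym (zeroʳ a))
      ... | yes (c , t₁ , t₁′ , v≡) | yes (c′ , t₂ , t₂′ , w≡) =
        x-y≡0⇒x≡y _ _ (free (b * c - a * c′) (b * t₁ - a * t₂ - t) (b * t₁′ - a * t₂′) λ k → begin
          (b * c - a * c′) * u k + ((b * t₁ - a * t₂ - t) * p k + (b * t₁′ - a * t₂′) * z k)
            ≡⟨ solve 12 (λ a b t c c′ t₁ t₁′ t₂ t₂′ u p z →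
                 (b :* c :- a :* c′) :* u :+ ((b :* t₁ :- a :* t₂ :- t) :* p :+ (b :* t₁′ :- a :* t₂′) :* z) :=
                 b :* (c :* u :+ (t₁ :* p :+ t₁′ :* z)) :- (a :* (c′ :* u :+ (t₂ :* p :+ t₂′ :* z)) :+ t :* p))
                 refl a b t c c′ t₁ t₁′ t₂ t₂′ (u k) (p k) (z k) ⟩
          b * (c * u k + (t₁ * p k + t₁′ * z k)) - (a * (c′ * u k + (t₂ * p k + t₂′ * z k)) + t * p k)
            ≡⟨ cong₂ (λ v w → b * v - (a * w + t * p k)) (sym (v≡ k)) (sym (w≡ k)) ⟩
          b * v k - (a * w k + t * p k)
            ≡⟨ cong (_- (a * w k + t * p k)) (eq k) ⟩
          a * w k + t * p k - (a * w k + t * p k)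
            ≡⟨ -‿inverseʳ _ ⟩
          0# ∎)
        where open ≡-Reasoning
      ... | yes (c , co) | no none with a Fin.≟ 0#
      ...   | yes refl = trans (coefficient-vanish {w = w} eq co) (sym (zeroʳ 0#))
      ...   | no  a≢0  = contradiction (coefficient-transfer {v = v} a≢0 eq co) none
      -- The mirror image of the previous case: the relation is solved for `a * w`, with `- t` in
      -- place of `t`.
      functional-homogeneous {a} {b} {t} {v} {w} eq | no none | yes (c , co) with b Fin.≟ 0#
      ...   | yes refl = trans (zeroʳ 0#) (sym (coefficient-vanish {c = c} {w = v} eq′ co))
        where
        eq′ : ∀ k → a * w k ≡ 0# * v k + - t * p k
        eq′ k = trans (solve 3 (λ x t p → x := x :+ t :* p :+ (:- t) :* p) refl (a * w k) t (p k))
                      (cong (_+ - t * p k) (sym (eq k)))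
      ...   | no  b≢0  = contradiction (coefficient-transfer {v = w} b≢0 eq′ co) none
        where
        eq′ : ∀ k → a * w k ≡ b * v k + - t * p k
        eq′ k = trans (solve 3 (λ x t p → x := x :+ t :* p :+ (:- t) :* p) refl (a * w k) t (p k))
                      (cong (_+ - t * p k) (sym (eq k)))

      functional-none : ∀ {v} → (∀ c → ¬ Coefficient p z u v c) → functional p z u v ≡ 0#
      functional-none {v} none with Finₚ.any? (coefficient? p z u v)
      ... | yes (c , co) = contradiction co (none c)
      ... | no  _        = refl

  opaque
    unfolding functional

    -- The pairs `p`, `z` and `p′`, `z` span the same space, and only the coefficient of `u` modulo
    -- that space matters.
    functional-shift : ∀ {p p′ z u : V d} →
      (∀ c t t′ → (∀ k → c * u k + (t * p′ k + t′ * z k) ≡ 0#) → c ≡ 0#) →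
      (∀ k → p k ≡ p′ k + z k) → functional p z u ≗ functional p′ z u
    functional-shift {p} {p′} {z} {u} free p≡ v with Finₚ.any? (coefficient? p z u v)
    ... | yes (c , t , t′ , eq) = sym (functional-coefficient {p′} {z} {u} free (t , t + t′ , λ k →
      trans (eq k) (trans (cong (λ x → c * u k + (t * x + t′ * z k)) (p≡ k))
        (solve 6 (λ c t t′ u p z → c :* u :+ (t :* (p :+ z) :+ t′ :* z) := c :* u :+ (t :* p :+ (t :+ t′) :* z))
          refl c t t′ (u k) (p′ k) (z k)))))
    ... | no none = sym (functional-none free λ c (t , t′ , eq) → none (c , t , t′ - t , λ k →
      trans (eq k) (trans
        (solve 6 (λ c t t′ u p z → c :* u :+ (t :* p :+ t′ :* z) := c :* u :+ (t :* (p :+ z) :+ (t′ :- t) :* z))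
          refl c t t′ (u k) (p′ k) (z k))
        (cong (λ x → c * u k + (t * x + (t′ - t) * z k)) (sym (p≡ k))))))

-- Switching

decode : ∀ {q s} → Fin (q ^ s) → Vec (Fin q) s
decode e = tabulate (finToFun e)

decode-funToFin : ∀ {q s} (x : Vec (Fin q) s) → decode (funToFin (lookup x)) ≡ x
decode-funToFin x = trans (Vecₚ.tabulate-cong (Finₚ.finToFun-funToFin (lookup x))) (Vecₚ.tabulate∘lookup x)

anyVec? : ∀ {q s} {P : Vec (Fin q) s → Set} → Decidable P → Dec (∃ P)
anyVec? {P = P} P? = map′ (λ (e , Pe) → decode e , Pe)
                          (λ (x , Px) → funToFin (lookup x) , subst P (sym (decode-funToFin x)) Px)
                          (Finₚ.any? (P? ∘ decode))

module Switching {r : ℕ} (F : FiniteField (suc r)) {s k n : ℕ}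
  (col : Vec (Fin (suc r)) s → Fin k) (k≤ : k ≤ suc r ^ s)
  (code : ∀ j → Is1Code (λ x → col x ≡ j))
  (H : ℕ → Fin (suc s) → Fin (suc r))
  (independent : Columns.Independent F (suc s) n H) (covers : Columns.Covers F (suc s) n H)
  (s<n : s < n) (standard : ∀ {i} → i < suc s → H i ≡ Columns.unit F (suc s) i)
  where

  open FieldProperties F
  open Columns F (suc s) using (unit; unit-diag; unit-off; common-multiple)
  open Linear F
  open Functional F {suc s}

  private
    q = suc r

  -- Syndromes

  h : Fin n → V (suc s)
  h t = H (toℕ t)

  index : Fin (suc s) → Fin n
  index l = fromℕ< (ℕₚ.<-≤-trans (Finₚ.toℕ<n l) s<n)

  toℕ-index : ∀ l → toℕ (index l) ≡ toℕ l
  toℕ-index l = Finₚ.toℕ-fromℕ< _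

  ≢index : ∀ {t l} → t ≢ index l → toℕ t ≢ toℕ l
  ≢index t≢ eq = t≢ (Finₚ.toℕ-injective (trans eq (sym (toℕ-index _))))

  h-standard : ∀ {t} (l : Fin (suc s)) → toℕ t ≡ toℕ l → h t ≡ unit (toℕ l)
  h-standard l eq = trans (cong H eq) (standard (Finₚ.toℕ<n l))

  E : Vec (Fin q) s → Vec (Fin q) n
  E = embed F n

  syndrome : Vec (Fin q) n → V (suc s)
  syndrome y l = dot (λ t → h t l) y

  point : Vec (Fin q) s → V (suc s)
  point x zero    = 1#
  point x (suc l) = lookup x l

  -- The leading 0 separates targets from points, and the base `q` digits of `j` separate them from
  -- each other; `k≤` guarantees enough digit strings.
  target : Fin k → V (suc s)
  target j zero    = 0#
  target j (suc l) = finToFun (inject≤ j k≤) l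

  direction : Vec (Fin q) s → V (suc s)
  direction x l = point x l - target (col x) l

  pad : V s → V (suc s)
  pad z zero    = 0#
  pad z (suc l) = z l

  point-injective : ∀ {x x′} → point x ≗ point x′ → x ≡ x′
  point-injective eq = lookup-ext (eq ∘ suc)

  target-injective : ∀ {j j′} → target j ≗ target j′ → j ≡ j′
  target-injective eq = Finₚ.inject≤-injective k≤ k≤ _ _ (finToFun-injective {s} {q} (eq ∘ suc))

  point≢target : ∀ {x j} → ¬ (point x ≗ target j)
  point≢target eq = 0≢1 (sym (eq zero))

  embed-index : ∀ x l → lookup (E x) (index l) ≡ point x l
  embed-index x zero    = embed-head F x _ (toℕ-index zero)
  embed-index x (suc l) = embed-middle F x _ l (toℕ-index (suc l))

  -- `E x` is supported on the first `s + 1` positions, where the columns form the identity matrix.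
  syndrome-embed : ∀ x → syndrome (E x) ≗ point x
  syndrome-embed x l = begin
    syndrome (E x) l                              ≡⟨ dot-single _ (E x) (index l) vanish ⟩
    h (index l) l * lookup (E x) (index l)        ≡⟨ cong₂ _*_ (cong-app (h-standard l (toℕ-index l)) l) (embed-index x l) ⟩
    unit (toℕ l) l * point x l                    ≡⟨ cong (_* point x l) (unit-diag l refl) ⟩
    1# * point x l                                ≡⟨ *-identityˡ _ ⟩
    point x l                                     ∎
    where
    open ≡-Reasoning
    vanish : ∀ t → t ≢ index l → h t l * lookup (E x) t ≡ 0#
    vanish t t≢ with toℕ t ℕ.≤? s
    ... | yes t≤s = trans (cong (_* lookup (E x) t) (trans (cong-app (standard {toℕ t} (ℕ.s≤s t≤s)) l) (unit-off l (≢index t≢))))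
                          (zeroˡ _)
    ... | no  t≰s = trans (cong (h t l *_) (embed-tail F x t (ℕₚ.≰⇒> t≰s))) (zeroʳ _)

  syndrome-bump : ∀ w i a → ∀ l → syndrome (bump w i a) l ≡ syndrome w l + a * h i l
  syndrome-bump w i a l = dot-bump (λ t → h t l) w i a

  opaque
    -- Syndrome decoding: the defect `c l - syndrome w l` is a multiple of some column, and this
    -- multiple is the error to add.
    near-syndrome : ∀ w (c : V (suc s)) → ∃ λ y → Near w y × syndrome y ≗ c
    near-syndrome w c with covers (λ l → c l - syndrome w l)
    ... | i , a , eq = bump w i a , (i , a , refl) , λ l → begin
      syndrome (bump w i a) l            ≡⟨ syndrome-bump w i a l ⟩
      syndrome w l + a * h i l           ≡⟨ cong (_+_ (syndrome w l)) (eq l) ⟨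
      syndrome w l + (c l - syndrome w l) ≡⟨ solve 2 (λ x y → x :+ (y :- x) := y) refl (syndrome w l) (c l) ⟩
      c l                                ∎
      where open ≡-Reasoning

  syndrome-injective : ∀ {w y y′} → Near w y → Near w y′ → syndrome y ≗ syndrome y′ → y ≡ y′
  syndrome-injective {w} (i , a , refl) (i′ , a′ , refl) eq =
    bump-cong (common-multiple independent (Finₚ.toℕ<n i) (Finₚ.toℕ<n i′) λ l →
      +-cancelˡ (syndrome w l) _ _ (trans (sym (syndrome-bump w i a l)) (trans (eq l) (syndrome-bump w i′ a′ l))))
    where
    bump-cong : ∀ {a a′} → (a ≡ 0# × a′ ≡ 0#) ⊎ (toℕ i ≡ toℕ i′ × a ≡ a′) → bump w i a ≡ bump w i′ a′
    bump-cong (inj₁ (refl , refl)) = trans (bump-zero w i) (sym (bump-zero w i′))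
    bump-cong {a} (inj₂ (i≡i′ , refl)) = cong (λ j → bump w j a) (Finₚ.toℕ-injective i≡i′)

  -- Functionals that separate words of one class

  Spread : V s → Set
  -- For `s` at least 1 this is weight at least 3, in the form in which it is applied: no two
  -- positions carry the whole support.
  Spread z = ∀ i l → ∃ λ m → m ≢ i × m ≢ l × z m ≢ 0#

  spread? : Decidable Spread
  spread? z = Finₚ.all? λ i → Finₚ.all? λ l → Finₚ.any? λ m →
    ¬? (m Fin.≟ i) ×-dec ¬? (m Fin.≟ l) ×-dec ¬? (z m Fin.≟ 0#)

  axis : Fin s → V (suc s)
  axis i = unit (suc (toℕ i))

  axis-diag : ∀ i → axis i (suc i) ≡ 1#
  axis-diag i = unit-diag (suc i) refl

  axis-off : ∀ {i l} → l ≢ i → axis i (suc l) ≡ 0#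
  axis-off l≢i = unit-off _ λ eq → l≢i (Finₚ.toℕ-injective (sym (ℕₚ.suc-injective eq)))

  axis-head : ∀ i → axis i zero ≡ 0#
  axis-head i = unit-off {suc (toℕ i)} zero λ ()

  -- Coordinate 0 of `direction x` is 1 and that of the other three vectors is 0, which kills `t`; a
  -- nonzero coordinate of `z` away from `i` and `l` then kills `t′`.
  spread-free : ∀ {z} → Spread z → ∀ x i l {c c′ t t′} →
    (∀ k → c * axis i k + c′ * axis l k + (t * direction x k + t′ * pad z k) ≡ 0#) → t ≡ 0# × t′ ≡ 0#
  spread-free {z} spread x i l {c} {c′} {t} {t′} eq = t≡0 , t′≡0
    where
    open ≡-Reasoning
    t≡0 : t ≡ 0#
    t≡0 = begin
      t
        ≡⟨ solve 4 (λ c c′ t t′ → t := c :* con (+ 0) :+ c′ :* con (+ 0) :+ (t :* (con (+ 1) :- con (+ 0)) :+ t′ :* con (+ 0))) refl c c′ t t′ ⟩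
      c * 0# + c′ * 0# + (t * direction x zero + t′ * 0#)
        ≡⟨ cong₂ (λ u v → c * u + c′ * v + (t * direction x zero + t′ * 0#)) (axis-head i) (axis-head l) ⟨
      c * axis i zero + c′ * axis l zero + (t * direction x zero + t′ * 0#)
        ≡⟨ eq zero ⟩
      0# ∎
    t′≡0 : t′ ≡ 0#
    t′≡0 with spread i l
    ... | m , m≢i , m≢l , zm≢0 = *-cancel-nonzero zm≢0 (begin
      z m * t′
        ≡⟨ solve 5 (λ c c′ d t′ z → z :* t′ := c :* con (+ 0) :+ c′ :* con (+ 0) :+ (con (+ 0) :* d :+ t′ :* z)) refl c c′ (direction x (suc m)) t′ (z m) ⟩
      c * 0# + c′ * 0# + (0# * direction x (suc m) + t′ * z m)
        ≡⟨ cong₂ (λ u v → c * u + c′ * v + (0# * direction x (suc m) + t′ * z m)) (axis-off m≢i) (axis-off m≢l) ⟨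
      c * axis i (suc m) + c′ * axis l (suc m) + (0# * direction x (suc m) + t′ * z m)
        ≡⟨ cong (λ t → c * axis i (suc m) + c′ * axis l (suc m) + (t * direction x (suc m) + t′ * z m)) t≡0 ⟨
      c * axis i (suc m) + c′ * axis l (suc m) + (t * direction x (suc m) + t′ * z m)
        ≡⟨ eq (suc m) ⟩
      0# ∎)

  test : Vec (Fin q) s → V s → Fin s → V (suc s) → Fin q
  test x z i = functional (direction x) (pad z) (axis i)

  module _ {z} (spread : Spread z) (x : Vec (Fin q) s) (i : Fin s) where
    open ≡-Reasoning

    axis-free : ∀ c t t′ → (∀ k → c * axis i k + (t * direction x k + t′ * pad z k) ≡ 0#) → c ≡ 0#
    axis-free c t t′ eq = begin
      c
        ≡⟨ solve 3 (λ c a b → c := c :* con (+ 1) :+ (con (+ 0) :* a :+ con (+ 0) :* b)) refl c (direction x (suc i)) (z i) ⟩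
      c * 1# + (0# * direction x (suc i) + 0# * z i)
        ≡⟨ cong (λ u → c * u + (0# * direction x (suc i) + 0# * z i)) (axis-diag i) ⟨
      c * axis i (suc i) + (0# * direction x (suc i) + 0# * z i)
        ≡⟨ cong₂ (λ t t′ → c * axis i (suc i) + (t * direction x (suc i) + t′ * z i)) (proj₁ t≡0) (proj₂ t≡0) ⟨
      c * axis i (suc i) + (t * direction x (suc i) + t′ * z i)
        ≡⟨ eq (suc i) ⟩
      0# ∎
      where
      -- Only one axis occurs here, so it is taken twice, the second time with coefficient 0.
      t≡0 = spread-free spread x i i {c} {0#} {t} {t′} λ k →
        trans (solve 3 (λ a b d → a :+ con (+ 0) :* b :+ d := a :+ d) refl (c * axis i k) (axis i k) _) (eq k)

    test-diag : test x z i (axis i) ≡ 1#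
    test-diag = functional-coefficient {direction x} {pad z} {axis i} axis-free (0# , 0# , λ k →
      solve 3 (λ u a b → u := con (+ 1) :* u :+ (con (+ 0) :* a :+ con (+ 0) :* b)) refl (axis i k) (direction x k) (pad z k))

    -- `axis l` lies outside the span defining the functional, hence gets the default value: by
    -- `spread-free` it would otherwise be a multiple of `axis i`.
    test-off : ∀ {l} → l ≢ i → test x z i (axis l) ≡ 0#
    test-off {l} l≢i = functional-none {direction x} {pad z} {axis i} axis-free none
      where
      none : ∀ c → ¬ Coefficient (direction x) (pad z) (axis i) (axis l) c
      none c (t , t′ , eq) = 0≢1 (begin
        0#
          ≡⟨ solve 3 (λ c a b → con (+ 0) := c :* con (+ 0) :+ (con (+ 0) :* a :+ con (+ 0) :* b)) refl c (direction x (suc l)) (z l) ⟩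
        c * 0# + (0# * direction x (suc l) + 0# * z l)
          ≡⟨ cong (λ u → c * u + (0# * direction x (suc l) + 0# * z l)) (axis-off l≢i) ⟨
        c * axis i (suc l) + (0# * direction x (suc l) + 0# * z l)
          ≡⟨ cong₂ (λ t t′ → c * axis i (suc l) + (t * direction x (suc l) + t′ * z l)) (proj₁ t≡0) (proj₂ t≡0) ⟨
        c * axis i (suc l) + (t * direction x (suc l) + t′ * z l)
          ≡⟨ eq (suc l) ⟨
        axis l (suc l)
          ≡⟨ axis-diag l ⟩
        1# ∎)
        where
        t≡0 = spread-free spread x i l {c} { - 1#} {t} {t′} λ k → trans
          (solve 3 (λ a b d → a :+ (:- con (+ 1)) :* b :+ d := (a :+ d) :- b) refl (c * axis i k) (axis l k) _)
          (trans (cong (_- axis l k) (sym (eq k))) (-‿inverseʳ _))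

    -- Both words have the same head and tail, and the middle positions other than that of `i` have
    -- weight 0. The head may have nonzero weight, so only differences are read off.
    dot-test-difference : ∀ x₁ x₂ →
      dot (test x z i ∘ h) (E x₁) ≡ dot (test x z i ∘ h) (E x₂) → lookup x₁ i ≡ lookup x₂ i
    dot-test-difference x₁ x₂ eq = x-y≡0⇒x≡y _ _ (+-cancelˡ (dot g (E x₂)) _ _ (begin
      dot g (E x₂) + (lookup x₁ i - lookup x₂ i)
        ≡⟨ cong₂ (λ a b → dot g (E x₂) + (a - b)) (value x₁) (value x₂) ⟨
      dot g (E x₂) + (g t * lookup (E x₁) t - g t * lookup (E x₂) t)
        ≡⟨ dot-differ-at g (E x₁) (E x₂) t same ⟨
      dot g (E x₁)
        ≡⟨ eq ⟩
      dot g (E x₂)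
        ≡⟨ +-identityʳ _ ⟨
      dot g (E x₂) + 0# ∎))
      where
      g = test x z i ∘ h
      t = index (suc i)
      value : ∀ x′ → g t * lookup (E x′) t ≡ lookup x′ i
      value x′ = begin
        g t * lookup (E x′) t     ≡⟨ cong₂ _*_ (cong (test x z i) (h-standard (suc i) (toℕ-index (suc i)))) (embed-index x′ (suc i)) ⟩
        test x z i (axis i) * lookup x′ i ≡⟨ cong (_* lookup x′ i) test-diag ⟩
        1# * lookup x′ i          ≡⟨ *-identityˡ _ ⟩
        lookup x′ i               ∎
      same : ∀ k → k ≢ t → g k * lookup (E x₁) k ≡ g k * lookup (E x₂) k
      same k k≢t with position s (toℕ k)
      ... | head eq     = cong (g k *_) (trans (embed-head F x₁ k eq) (sym (embed-head F x₂ k eq)))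
      ... | tail s<k    = cong (g k *_) (trans (embed-tail F x₁ k s<k) (sym (embed-tail F x₂ k s<k)))
      ... | middle l eq = trans (cong (_* lookup (E x₁) k) g≡0) (trans (zeroˡ _) (sym (trans (cong (_* lookup (E x₂) k) g≡0) (zeroˡ _))))
        where
        g≡0 : g k ≡ 0#
        g≡0 = trans (cong (test x z i) (h-standard (suc l) eq))
                    (test-off λ l≡i → ≢index k≢t (trans eq (cong (suc ∘ toℕ) l≡i)))

  -- The switching components

  Component : Vec (Fin q) s → Vec (Fin q) n → Set
  -- All spread `z` are used at once, so the set depends on `x` alone and not on the word it is to
  -- be separated from; `z` ranges over codes in `Fin (q ^ s)` to keep membership decidable.
  Component x y = ∀ (e : Fin (q ^ s)) → Spread (finToFun e) → ∀ i →
    dot (test x (finToFun e) i ∘ h) y ≡ dot (test x (finToFun e) i ∘ h) (E x)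

  component? : ∀ x → Decidable (Component x)
  component? x y = Finₚ.all? λ e → spread? (finToFun e) →-dec Finₚ.all? λ i → _ Fin.≟ _

  -- Cancelling the syndrome of the centre `w` leaves a relation between the two errors, to which
  -- `functional-homogeneous` applies: both errors contribute equally to every test.
  component-closed : ∀ {x w y y′ t} → Near w y → Near w y′ →
    (∀ l → syndrome y′ l ≡ syndrome y l + t * direction x l) → Component x y → Component x y′
  component-closed {x} {w} {t = t} (i , a , refl) (i′ , a′ , refl) eq y∈ e spread j = trans (begin
    dot g (bump w i′ a′)       ≡⟨ dot-bump g w i′ a′ ⟩
    dot g w + a′ * g i′        ≡⟨ cong (_+_ (dot g w)) (functional-homogeneous {direction x} {pad (finToFun e)} {axis j} (axis-free spread x j) {t = t} h-related) ⟩
    dot g w + a * g i          ≡⟨ dot-bump g w i a ⟨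
    dot g (bump w i a)         ∎) (y∈ e spread j)
    where
    open ≡-Reasoning
    g = test x (finToFun e) j ∘ h
    h-related : ∀ l → a′ * h i′ l ≡ a * h i l + t * direction x l
    h-related l = +-cancelˡ (syndrome w l) _ _ (begin
      syndrome w l + a′ * h i′ l                         ≡⟨ syndrome-bump w i′ a′ l ⟨
      syndrome (bump w i′ a′) l                          ≡⟨ eq l ⟩
      syndrome (bump w i a) l + t * direction x l        ≡⟨ cong (_+ t * direction x l) (syndrome-bump w i a l) ⟩
      syndrome w l + a * h i l + t * direction x l       ≡⟨ +-assoc _ _ _ ⟩
      syndrome w l + (a * h i l + t * direction x l)     ∎)

  -- For `z` the difference of `x` and `x′`, the tests of `x` and of `x′` coincide, so a common
  -- element would give `E x` and `E x′` the same value; at a coordinate where `x` and `x′` differ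
  -- the test tells them apart.
  component-disjoint : ∀ {x x′ y} → col x ≡ col x′ → Component x y → Component x′ y → x ≡ x′
  component-disjoint {x} {x′} {y} same-col y∈ y∈′ with anyDiffer
    where
    anyDiffer : Dec (∃ λ i → lookup x i ≢ lookup x′ i)
    anyDiffer = Finₚ.any? λ i → ¬? (lookup x i Fin.≟ lookup x′ i)
  ... | no  none     = lookup-ext λ i → decidable-stable (lookup x i Fin.≟ lookup x′ i) λ ≢ → none (i , ≢)
  ... | yes (i , xi≢x′i) = contradiction (dot-test-difference spread x i x x′ (begin
      dot g (E x)     ≡⟨ y∈ e spread i ⟨
      dot g y         ≡⟨ dot-congˡ y g≗g′ ⟩
      dot g′ y        ≡⟨ y∈′ e spread i ⟩
      dot g′ (E x′)   ≡⟨ dot-congˡ (E x′) g≗g′ ⟨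
      dot g (E x′)    ∎)) xi≢x′i
    where
    open ≡-Reasoning
    e : Fin (q ^ s)
    e = funToFin λ l → lookup x l - lookup x′ l
    z : V s
    z = finToFun e
    z≗ : ∀ l → z l ≡ lookup x l - lookup x′ l
    z≗ = Finₚ.finToFun-funToFin _
    spread : Spread z
    spread i l with differ-off-two (code (col x)) refl (sym same-col) (λ x≡x′ → xi≢x′i (cong (λ v → lookup v _) x≡x′)) i l
    ... | m , m≢i , m≢l , xm≢x′m = m , m≢i , m≢l , λ zm≡0 → xm≢x′m (x-y≡0⇒x≡y _ _ (trans (sym (z≗ m)) zm≡0))
    -- Words of one class share their target, which cancels in the difference of directions.
    shift : ∀ k → direction x k ≡ direction x′ k + pad z k
    shift zero    = sym (+-identityʳ _)
    shift (suc l) rewrite z≗ l | same-col =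
      solve 3 (λ x x′ m → x :- m := x′ :- m :+ (x :- x′)) refl (lookup x l) (lookup x′ l) _
    g  = test x z i ∘ h
    g′ = test x′ z i ∘ h
    g≗g′ : g ≗ g′
    g≗g′ t = functional-shift {direction x} {direction x′} {pad z} {axis i} (axis-free spread x′ i) shift (h t)

  embed∈component : ∀ x → Component x (E x)
  embed∈component x e spread i = refl

  -- Exchanging colours

  AtPoint AtTarget : Vec (Fin q) n → V (suc s) → Vec (Fin q) s → Set
  AtPoint  y c x = Component x y × c ≗ point x
  AtTarget y c x = Component x y × c ≗ target (col x)

  at? : ∀ (f : Vec (Fin q) s → V (suc s)) y c → Decidable λ x → Component x y × c ≗ f x
  at? f y c x = component? x y ×-dec Finₚ.all? λ l → c l Fin.≟ f x l

  switch : Vec (Fin q) n → V (suc s) → V (suc s)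
  switch y c with anyVec? (at? point y c)
  ... | yes (x , _) = target (col x)
  ... | no _ with anyVec? (at? (target ∘ col) y c)
  ...   | yes (x , _) = point x
  ...   | no _        = c

  colour : Vec (Fin q) n → V (suc s)
  colour y = switch y (syndrome y)

  switch-point : ∀ {y c x} → AtPoint y c x → switch y c ≗ target (col x)
  switch-point {y} {c} (y∈ , c≗) l with anyVec? (at? point y c)
  ... | yes (x′ , _ , c≗′) rewrite point-injective (λ l → trans (sym (c≗′ l)) (c≗ l)) = refl
  ... | no none = contradiction (_ , y∈ , c≗) none

  -- A target colour reveals only the class; that the search finds `x` itself is due to the
  -- disjointness of the components within a class.
  switch-target : ∀ {y c x} → AtTarget y c x → switch y c ≗ point x
  switch-target {y} {c} {x} (y∈ , c≗) l with anyVec? (at? point y c)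
  ... | yes (x′ , _ , c≗′) = contradiction (λ l → trans (sym (c≗′ l)) (c≗ l)) (point≢target {x′} {col x})
  ... | no _ with anyVec? (at? (target ∘ col) y c)
  ...   | yes (x′ , y∈′ , c≗′)
            rewrite component-disjoint (target-injective λ l → trans (sym (c≗′ l)) (c≗ l)) y∈′ y∈ = refl
  ...   | no none = contradiction (_ , y∈ , c≗) none

  data Switch (y : Vec (Fin q) n) : Set where
    at-point  : ∀ x → AtPoint  y (syndrome y) x → Switch y
    at-target : ∀ x → AtTarget y (syndrome y) x → Switch y
    fixed     : colour y ≡ syndrome y → Switch y

  switch-view : ∀ y → Switch y
  switch-view y with anyVec? (at? point y (syndrome y)) in eq
  ... | yes (x , at) = at-point x at
  ... | no _ with anyVec? (at? (target ∘ col) y (syndrome y)) in eq′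
  ...   | yes (x , at) = at-target x at
  ...   | no _         = fixed switch-none
    where
    switch-none : colour y ≡ syndrome y
    switch-none rewrite eq | eq′ = refl

  -- Inside one ball the exchange is an involution: the word of the ball whose syndrome is the new
  -- colour of `y` lies in the same component, so its own syndrome is switched back.
  partner : ∀ {w y} → Near w y → ∃ λ y′ → Near w y′ × syndrome y′ ≗ colour y × colour y′ ≗ syndrome y
  partner {w} {y} near with switch-view y
  ... | fixed eq = y , near , (λ l → cong (λ v → v l) (sym eq)) , (λ l → cong (λ v → v l) eq)
  ... | at-point x (y∈ , c≗) with near-syndrome w (target (col x))
  ...   | y′ , near′ , c≗′ = y′ , near′
    , (λ l → trans (c≗′ l) (sym (switch-point (y∈ , c≗) l)))
    , (λ l → trans (switch-target (y∈′ , c≗′) l) (sym (c≗ l)))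
    where
    y∈′ : Component x y′
    -- The target is the point minus the direction.
    y∈′ = component-closed {t = - 1#} near near′ (λ l → trans (c≗′ l)
      (trans (solve 2 (λ p m → m := p :+ (:- con (+ 1)) :* (p :- m)) refl (point x l) (target (col x) l))
             (cong (_+ - 1# * direction x l) (sym (c≗ l))))) y∈
  partner {w} {y} near | at-target x (y∈ , c≗) with near-syndrome w (point x)
  ...   | y′ , near′ , c≗′ = y′ , near′
    , (λ l → trans (c≗′ l) (sym (switch-target (y∈ , c≗) l)))
    , (λ l → trans (switch-point (y∈′ , c≗′) l) (sym (c≗ l)))
    where
    y∈′ : Component x y′
    y∈′ = component-closed {t = 1#} near near′ (λ l → trans (c≗′ l)
      (trans (solve 2 (λ p m → p := m :+ con (+ 1) :* (p :- m)) refl (point x l) (target (col x) l))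
             (cong (_+ 1# * direction x l) (sym (c≗ l))))) y∈

  -- Words of equal colour have partners of equal syndrome, hence the same partner, and its colour
  -- is the syndrome of both.
  colour-injective : ∀ {w y y′} → Near w y → Near w y′ → colour y ≗ colour y′ → y ≡ y′
  colour-injective near₁ near₂ eq with partner near₁ | partner near₂
  ... | y₁ , near₁′ , s₁ , c₁ | y₂ , near₂′ , s₂ , c₂
    with syndrome-injective near₁′ near₂′ (λ l → trans (s₁ l) (trans (eq l) (sym (s₂ l))))
  ... | refl = syndrome-injective near₁ near₂ λ l → trans (sym (c₁ l)) (c₂ l)

  colour-surjective : ∀ w c → ∃ λ y → Near w y × colour y ≗ c
  colour-surjective w c with near-syndrome w c
  ... | y , near , s≗c with partner near
  ...   | y′ , near′ , _ , c′ = y′ , near′ , λ l → trans (c′ l) (s≗c l)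

  colour-embed : ∀ x → colour (E x) ≗ target (col x)
  colour-embed x = switch-point (embed∈component x , syndrome-embed x)

  -- Numbering the codes

  translate : Fin q → V (suc s) → V (suc s)
  translate a v zero    = v zero + a
  translate a v (suc l) = v (suc l)

  -- Translating the leading coordinate by the element numbered 0 sends 0# to that element, so that
  -- the digit expansion of target j is the number j.
  label : V (suc s) → Fin (q ^ suc s)
  label v = funToFin (translate zero v)

  label-cong : ∀ {u v} → u ≗ v → label u ≡ label v
  label-cong {u} {v} u≗v = funToFin-cong {f = translate zero u} {translate zero v} λ { zero → cong (_+ zero) (u≗v zero) ; (suc l) → u≗v (suc l) }

  label-injective : ∀ {u v} → label u ≡ label v → u ≗ v
  label-injective {u} {v} eq l with funToFin-injective {f = translate zero u} {translate zero v} eq l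
  label-injective eq zero    | eq₀ = +-cancelʳ zero _ _ eq₀
  label-injective eq (suc l) | eqₗ = eqₗ

  label-surjective : ∀ e → ∃ λ v → label v ≡ e
  label-surjective e = translate (- zero) (finToFun e) ,
    trans (funToFin-cong {f = translate zero (translate (- zero) (finToFun e))} {finToFun e} λ
            { zero    → solve 2 (λ x z → x :+ :- z :+ z := x) refl (finToFun {q} {suc s} e zero) zero
            ; (suc l) → refl })
          (Finₚ.funToFin-finToFin {suc s} {q} e)

  toℕ-label-target : ∀ j → toℕ (label (target j)) ≡ toℕ j
  toℕ-label-target j = begin
    toℕ (label (target j))
      ≡⟨ cong₂ (λ a b → toℕ (combine a b)) (+-identityˡ zero) (Finₚ.funToFin-finToFin {s} {q} (inject≤ j k≤)) ⟩
    toℕ (combine {q} zero (inject≤ j k≤))    ≡⟨ Finₚ.toℕ-combine {q} zero (inject≤ j k≤) ⟩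
    q ^ s ℕ.* 0 ℕ.+ toℕ (inject≤ j k≤)       ≡⟨ cong (ℕ._+ toℕ (inject≤ j k≤)) (ℕₚ.*-zeroʳ (q ^ s)) ⟩
    toℕ (inject≤ j k≤)                       ≡⟨ Finₚ.toℕ-inject≤ j k≤ ⟩
    toℕ j                                    ∎
    where open ≡-Reasoning

  partition : Vec (Fin q) n → Fin (q ^ suc s)
  partition y = label (colour y)

  -- Each ball contains every colour exactly once: uniqueness separates the neighbourhoods,
  -- existence makes them cover.
  partition-perfect : ∀ i → Is1Perfect (λ y → partition y ≡ i)
  partition-perfect i = separated , covered
    where
    separated : Is1Code (λ y → partition y ≡ i)
    separated c c′ pc pc′ c≢c′ v (d , d′) = c≢c′ (colour-injective
      (hamming≤1⇒near v c (index zero) d) (hamming≤1⇒near v c′ (index zero) d′)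
      (label-injective (trans pc (sym pc′))))
    covered : ∀ v → Ω (λ y → partition y ≡ i) v
    covered v with label-surjective i
    ... | c , refl with colour-surjective v c
    ...   | y , near , eq = y , label-cong eq , near⇒hamming≤1 near

  partition-extends : ∀ j x → col x ≡ j ⇔ toℕ (partition (E x)) ≡ toℕ j
  partition-extends j x = mk⇔ (trans value ∘ cong toℕ) (Finₚ.toℕ-injective ∘ trans (sym value))
    where
    value : toℕ (partition (E x)) ≡ toℕ (col x)
    value = trans (cong toℕ (label-cong (colour-embed x))) (toℕ-label-target (col x))

-- The number of classes, the length, and the theorem

surjective⇒≤ : ∀ {q s k} (col : Vec (Fin q) s → Fin k) → (∀ j → ∃ λ x → col x ≡ j) → k ≤ q ^ s
-- One word is chosen from each class, and distinct classes give distinct words.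
surjective⇒≤ {q} {s} col surj = Finₚ.injective⇒≤ {f = λ j → funToFin (lookup (proj₁ (surj j)))} λ {j} {j′} eq →
  trans (sym (proj₂ (surj j))) (trans (cong col (lookup-ext (funToFin-injective eq))) (proj₂ (surj j′)))

theorem2 : (q : ℕ) (F : FiniteField q) .{{_ : NonZero (q ∸ 1)}} (s : ℕ) → 1 ≤ s →
    (k : ℕ) (col : Vec (Fin q) s → Fin k) →
    (∀ j → ∃ λ x → col x ≡ j) →
    (∀ j → Is1Code (λ x → col x ≡ j)) →
    Σ (Vec (Fin q) (hammingLength q s) → Fin (q ^ suc s)) λ p →
    (∀ i → Is1Perfect (λ y → p y ≡ i)) ×
    (∀ (j : Fin k) (x : Vec (Fin q) s) →
    col x ≡ j ⇔ toℕ (p (embed F (hammingLength q s) x)) ≡ toℕ j)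
theorem2 (suc r) F s _ k col surj code =
  subst (λ n → Σ (Vec (Fin (suc r)) n → Fin (suc r ^ suc s)) λ p →
                 (∀ i → Is1Perfect (λ y → p y ≡ i)) ×
                 (∀ j x → col x ≡ j ⇔ toℕ (p (embed F n x)) ≡ toℕ j))
        size≡ (partition , partition-perfect , partition-extends)
  where
  open Columns F (suc s)
  completion : Completion (suc s) unit
  -- This fuel exceeds the number of vectors by 1, so the strict bound holds whatever the number of
  -- initial columns.
  completion = complete (suc (suc r ^ suc s)) unit-independent (ℕ.s≤s ℕ.z≤n)
    (ℕₚ.m≤m+n (suc (suc r ^ suc s)) (suc s))
  open Completion completion
  open Switching F col (surjective⇒≤ col surj) code columns independent covers m≤size agrees
  size≡ : size ≡ hammingLength (suc r) s
  -- The two counting bounds give `suc (size * r)` equal to `suc r ^ suc s`, which is then solved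
  -- for `size`.
  size≡ = begin
    size                                ≡⟨ DivMod.m*n/n≡m size r ⟨
    (suc (size ℕ.* r) ∸ 1) DivMod./ r   ≡⟨ cong (λ N → (N ∸ 1) DivMod./ r) (ℕₚ.≤-antisym (independent⇒≤ independent) (covers⇒≥ {H = columns} covers)) ⟩
    hammingLength (suc r) s             ∎
    where open ≡-Reasoning
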